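{- There are infinitely many (pairwise non-isomorphic) $4$-critical $P_7$-free graphs.
   Context: All graphs are finite, simple and undirected. $P_t$ denotes the path on $t$ vertices. A graph is $k$-colorable if it admits a proper vertex coloring with $k$ colors, and $k$-chromatic if it is $k$-colorable but not $(k-1)$-colorable. A graph is $H$-free if it does not contain $H$ as an induced subgraph. A graph $G$ is called $k$-critical $H$-free if $G$ is $H$-free, $G$ is $k$-chromatic, and every $H$-free proper subgraph of $G$ (subgraphs are not required to be induced) is $(k-1)$-colorable. -}

module Defs where

open import Data.Fin using (Fin; toℕ)
open import Data.Fin.Subset using (Subset; _∈_)
open import Data.Nat using (ℕ; suc; pred; NonZero)
open import Data.Nat.Properties using (_≟_; 1+n≢n)
open import Data.Product using (Σ; ∃; _×_; _,_; proj₁)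
open import Data.Sum using (_⊎_; inj₁; inj₂; swap)
open import Function.Bundles using (_↔_; _↣_; _⇔_; Inverse; Injection)
open import Level using (0ℓ)
open import Relation.Binary.Core using (Rel)
open import Relation.Binary.Definitions using (Symmetric; Irreflexive; Decidable)
open import Relation.Binary.PropositionalEquality using (_≡_; _≢_; refl; cong)
open import Relation.Nullary using (¬_)
open import Relation.Nullary.Decidable using (_⊎-dec_)

-- Adjacency is required to be decidable, which holds classically for every
-- graph; finiteness is imposed by taking V = Fin n.
record Graph (V : Set) : Set₁ where
  field
    _~_      : Rel V 0ℓ
    _~?_     : Decidable _~_
    ~-sym    : Symmetric _~_
    ~-irrefl : Irreflexive _≡_ _~_

FiniteGraph : Set₁
FiniteGraph = ∃ λ n → Graph (Fin n)

record _≅_ {V W : Set} (G : Graph V) (H : Graph W) : Set where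
  private
    module G = Graph G
    module H = Graph H
  field
    bijection : V ↔ W
    ~-iff : ∀ u v → (u G.~ v) ⇔ (Inverse.to bijection u H.~ Inverse.to bijection v)

-- An embedding of G onto an induced subgraph of H.
record InducedEmbedding {V W : Set} (G : Graph V) (H : Graph W) : Set where
  private
    module G = Graph G
    module H = Graph H
  field
    injection : V ↣ W
    ~-iff : ∀ u v → (u G.~ v) ⇔ (Injection.to injection u H.~ Injection.to injection v)

infix 4 _-Free_

_-Free_ : {V W : Set} → Graph W → Graph V → Set
H -Free G = ¬ InducedEmbedding H G

Path : (t : ℕ) → Graph (Fin t)
Path t = record
  { _~_      = λ i j → suc (toℕ i) ≡ toℕ j ⊎ suc (toℕ j) ≡ toℕ i
  ; _~?_     = λ i j → (suc (toℕ i) ≟ toℕ j) ⊎-dec (suc (toℕ j) ≟ toℕ i)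
  ; ~-sym    = swap
  ; ~-irrefl = λ { refl (inj₁ e) → 1+n≢n e ; refl (inj₂ e) → 1+n≢n e }
  }

Colorable : {V : Set} → ℕ → Graph V → Set
Colorable {V} k G = Σ (V → Fin k) λ c → ∀ {u v} → u ~ v → c u ≢ c v
  where open Graph G

-- k is required to be positive so that pred k really is k - 1.
Chromatic : {V : Set} (k : ℕ) .{{_ : NonZero k}} → Graph V → Set
Chromatic k G = Colorable k G × ¬ Colorable (pred k) G

-- A subgraph, not necessarily induced.  By symmetry, ~-source puts both
-- endpoints of every edge in the vertex set.
record Subgraph {n : ℕ} (G : Graph (Fin n)) : Set₁ where
  private module G = Graph G
  field
    vertices : Subset n
    _~_      : Rel (Fin n) 0ℓ
    _~?_     : Decidable _~_
    ~-sym    : Symmetric _~_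
    ~-source : ∀ {u v} → u ~ v → u ∈ vertices
    ~⇒~ᴳ     : ∀ {u v} → u ~ v → u G.~ v

  graph : Graph (∃ λ v → v ∈ vertices)
  graph = record
    { _~_      = λ u v → proj₁ u ~ proj₁ v
    ; _~?_     = λ u v → proj₁ u ~? proj₁ v
    ; ~-sym    = ~-sym
    ; ~-irrefl = λ u≡v u~v → G.~-irrefl (cong proj₁ u≡v) (~⇒~ᴳ u~v)
    }

  Proper : Set
  Proper = ¬ ((∀ v → v ∈ vertices) × (∀ {u v} → u G.~ v → u ~ v))

record CriticalFree {n : ℕ} {W : Set} (k : ℕ) .{{_ : NonZero k}}
                    (H : Graph W) (G : Graph (Fin n)) : Set₁ where
  field
    free      : H -Free G
    chromatic : Chromatic k G
    critical  : (S : Subgraph G) → Subgraph.Proper S →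
                H -Free Subgraph.graph S →
                Colorable (pred k) (Subgraph.graph S)

{-# OPTIONS --safe #-}

-- For r ≥ 1 let C_r be the circulant graph on ℤ/(3r+1) in which two vertices
-- are adjacent when they differ by ±1 or by a residue d ≡ 2 (mod 3), 0 < d < 3r.
-- Read from any vertex w, cut open as w, w+1, …, w+3r, the vertices other than w
-- are properly coloured by their distance from w modulo 3, while the
-- non-neighbours of w form a half graph between two of these colour classes; a
-- half graph contains no induced 2K₂, so C_r contains no induced 2K₂ + K₁, let
-- alone a P₇.  On the other hand {v, v+1, v+2} is always a triangle, so a
-- 3-colouring would have period 3, which is impossible modulo 3r+1.
--
-- Thus C_r is P₇-free and 4-vertex-critical.  A minimal edge set among its
-- P₇-free, non-3-colourable spanning subgraphs is then 4-critical P₇-free, and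
-- still has 3r+1 vertices, which separates different r.

module Submission where

open import Data.Fin using (Fin; zero; suc; toℕ; fromℕ<; combine; remQuot; finToFun; funToFin)
open import Data.Fin.Permutation using (↔⇒≡)
open import Data.Fin.Properties
  using ( _≟_; all?; any?; ¬∀⟶∃¬; finToFun-funToFin; remQuot-combine; combine-remQuot
        ; toℕ-injective; toℕ-fromℕ<; toℕ≤pred[n]; suc-injective)
open import Data.Fin.Patterns using (0F; 1F; 2F; 3F; 4F; 6F)
open import Data.Fin.Subset using (Subset; _∈_; _⊂_; _⊆_; ⊤)
open import Data.Fin.Subset.Induction using (⊂-wellFounded)
open import Data.Fin.Subset.Properties using (anySubset?; _∈?_; _⊂?_; ∈⊤)
open import Data.Nat using (ℕ; zero; suc; _+_; _*_; _≤_; _<_; z≤n; s≤s; s≤s⁻¹)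
import Data.Nat.Properties as ℕ
open import Data.Product using (Σ; ∃; _×_; _,_; proj₁; proj₂; uncurry)
open import Data.Sum using (_⊎_; inj₁; inj₂; [_,_]′; swap)
open import Data.Vec using (tabulate)
open import Data.Vec.Properties using (lookup∘tabulate; lookup⇒[]=; []=⇒lookup)
open import Function using (_∘_)
open import Function.Bundles using (Equivalence; Injection; mk⇔; mk↣)
open import Function.Construct.Composition using (_⇔-∘_; _↣-∘_)
open import Induction.WellFounded using (Acc; acc)
open import Relation.Binary.Definitions using (tri<; tri≈; tri>)
import Relation.Binary.Definitions as B
open import Relation.Binary.PropositionalEquality
  using (_≡_; _≢_; _≗_; refl; sym; trans; cong; subst; subst₂; ≢-sym)
open import Relation.Nullary using (¬_; Dec; yes; no; does; contradiction; ¬?)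
open import Relation.Nullary.Decidable
  using (map′; toWitness; toWitnessFalse; False; dec-true; decidable-stable; _×-dec_; _⊎-dec_; _→-dec_)
open import Relation.Unary using (Decidable)
open import Defs

-- Critical spanning subgraphs of vertex-critical graphs

-- Functions are enumerated through codes in a finite type, which recovers them only up to pointwise
-- equality; hence `P` has to respect `_≗_`.
anyFunction? : ∀ {m n} {P : (Fin m → Fin n) → Set} →
               (∀ {f g} → f ≗ g → P f → P g) → Decidable P → Dec (∃ P)
anyFunction? resp P? = map′
  (λ (i , Pi) → finToFun i , Pi)
  (λ (f , Pf) → funToFin f , resp (sym ∘ finToFun-funToFin f) Pf)
  (any? (P? ∘ finToFun))

colorable? : ∀ {n} k (G : Graph (Fin n)) → Dec (Colorable k G)
colorable? k G = map′
  (λ (c , proper) → c , λ {u} {v} → proper u v)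
  (λ (c , proper) → c , λ u v → proper)
  (anyFunction?
    (λ f≗g proper u v u~v → subst₂ _≢_ (f≗g u) (f≗g v) (proper u v u~v))
    (λ c → all? λ u → all? λ v → (u ~? v) →-dec ¬? (c u ≟ c v)))
  where open Graph G

embedding? : ∀ {t n} (H : Graph (Fin t)) (G : Graph (Fin n)) → Dec (InducedEmbedding H G)
embedding? H G = map′
  (λ (f , emb) → record
    { injection = mk↣ λ {u} {v} → proj₁ (emb u v)
    ; ~-iff     = λ u v → mk⇔ (proj₁ (proj₂ (emb u v))) (proj₂ (proj₂ (emb u v)))
    })
  (λ e → let open InducedEmbedding e in
    Injection.to injection , λ u v →
      Injection.injective injection , Equivalence.to (~-iff u v) , Equivalence.from (~-iff u v))
  (anyFunction?
    (λ f≗g emb u v → subst₂ (Embeds u v) (f≗g u) (f≗g v) (emb u v))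
    (λ f → all? λ u → all? λ v →
      ((f u ≟ f v) →-dec (u ≟ v)) ×-dec
      ((u H.~? v) →-dec (f u G.~? f v)) ×-dec
      ((f u G.~? f v) →-dec (u H.~? v))))
  where
  module G = Graph G
  module H = Graph H
  Embeds : _ → _ → _ → _ → Set
  Embeds u v x y = (x ≡ y → u ≡ v) × (u H.~ v → x G.~ y) × (x G.~ y → u H.~ v)

embedding-trans : ∀ {U V W} {F : Graph U} {G : Graph V} {H : Graph W} →
                  InducedEmbedding F G → InducedEmbedding G H → InducedEmbedding F H
embedding-trans e e′ = record
  { injection = E′.injection ↣-∘ E.injection
  ; ~-iff     = λ u v → E′.~-iff _ _ ⇔-∘ E.~-iff u v
  }
  where
  module E  = InducedEmbedding e
  module E′ = InducedEmbedding e′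

separate : ∀ {m} {P : Fin m → Set} → Decidable P → Subset m
separate P? = tabulate (does ∘ P?)

∈-separate⁺ : ∀ {m} {P : Fin m → Set} (P? : Decidable P) {i} → P i → i ∈ separate P?
∈-separate⁺ P? {i} Pi =
  lookup⇒[]= i _ (trans (lookup∘tabulate (does ∘ P?) i) (dec-true (P? i) Pi))

∈-separate⁻ : ∀ {m} {P : Fin m → Set} (P? : Decidable P) {i} → i ∈ separate P? → P i
∈-separate⁻ P? {i} i∈ with P? i | trans (sym (lookup∘tabulate (does ∘ P?) i)) ([]=⇒lookup i∈)
... | yes Pi | _ = Pi
... | no _   | ()

-- Descent along the well-founded `_⊂_`: decidability of `P` lets each round search all subsets for
-- a smaller solution.
⊂-minimal : ∀ {m} {P : Subset m → Set} → Decidable P → ∀ {E} → P E →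
            ∃ λ M → P M × (∀ {F} → F ⊂ M → ¬ P F)
⊂-minimal {m} {P} P? PE = search (⊂-wellFounded _) PE
  where
  search : ∀ {E} → Acc _⊂_ E → P E → ∃ λ M → P M × (∀ {F} → F ⊂ M → ¬ P F)
  search {E} (acc smaller) PE with anySubset? (λ F → (F ⊂? E) ×-dec P? F)
  ... | yes (F , F⊂E , PF) = search (smaller F⊂E) PF
  ... | no minimal         = E , PE , λ F⊂E PF → minimal (_ , F⊂E , PF)

-- The pair (u , v) is coded as combine u v; an edge is kept if both of its
-- orientations are selected.
restrict : ∀ {n} → Graph (Fin n) → Subset (n * n) → Graph (Fin n)
restrict G E = record
  { _~_      = λ u v → u ~ v × combine u v ∈ E × combine v u ∈ E
  ; _~?_     = λ u v → (u ~? v) ×-dec (combine u v ∈? E) ×-dec (combine v u ∈? E)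
  ; ~-sym    = λ (u~v , uv∈E , vu∈E) → ~-sym u~v , vu∈E , uv∈E
  ; ~-irrefl = λ u≡v (u~v , _) → ~-irrefl u≡v u~v
  }
  where open Graph G

-- A colouring of the vertex-deleted graph, kept total on `Fin n` to avoid a subtype; its value at
-- `x` is unconstrained.
ColorableWithout : ∀ {n} → ℕ → Graph (Fin n) → Fin n → Set
ColorableWithout {n} k G x = Σ (Fin n → Fin k) λ c → ∀ {u v} → u ≢ x → v ≢ x → u ~ v → c u ≢ c v
  where open Graph G

colorable-suc : ∀ {n k} {G : Graph (Fin n)} {x} → ColorableWithout k G x → Colorable (suc k) G
colorable-suc {n} {k} {G} {x} (c , proper) = c⁺ , proper⁺
  where
  open Graph G
  c⁺ : Fin n → Fin (suc k)
  c⁺ u with u ≟ x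
  ... | yes _ = zero
  ... | no _  = suc (c u)
  proper⁺ : ∀ {u v} → u ~ v → c⁺ u ≢ c⁺ v
  proper⁺ {u} {v} u~v with u ≟ x | v ≟ x
  ... | yes u≡x | yes v≡x = contradiction u~v (~-irrefl (trans u≡x (sym v≡x)))
  ... | yes _   | no _    = λ ()
  ... | no _    | yes _   = λ ()
  ... | no u≢x  | no v≢x  = proper u≢x v≢x u~v ∘ suc-injective

-- Subgraphs as sets of coded edges.

module _ {n : ℕ} (G : Graph (Fin n)) (E : Subset (n * n)) (S : Subgraph (restrict G E)) where
  private
    module G = Graph G
    module S = Subgraph S

  edge? : Decidable {A = Fin (n * n)} (uncurry S._~_ ∘ remQuot {n} n)
  edge? = uncurry S._~?_ ∘ remQuot {n} n

  edges : Subset (n * n)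
  edges = separate edge?

  combine∈edges⁺ : ∀ {u v} → u S.~ v → combine u v ∈ edges
  combine∈edges⁺ {u} {v} u~v =
    ∈-separate⁺ edge? (subst (uncurry S._~_) (sym (remQuot-combine u v)) u~v)

  combine∈edges⁻ : ∀ {u v} → combine u v ∈ edges → u S.~ v
  combine∈edges⁻ {u} {v} uv∈ =
    subst (uncurry S._~_) (remQuot-combine u v) (∈-separate⁻ edge? uv∈)

  edges⊆ : edges ⊆ E
  edges⊆ {i} i∈ = subst (_∈ E) (combine-remQuot {n} n i)
    (proj₁ (proj₂ (S.~⇒~ᴳ (∈-separate⁻ edge? i∈))))

  -- If the inclusion were not strict, every coded pair of `E` would be an edge of `S`, making `S`
  -- the whole restricted graph.
  edges⊂ : (∀ v → v ∈ S.vertices) → S.Proper → edges ⊂ E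
  edges⊂ spanning proper = decidable-stable (edges ⊂? E) λ edges⊄E →
    proper (spanning , λ {u} {v} (_ , uv∈E , _) → combine∈edges⁻
      (decidable-stable (combine u v ∈? edges) λ uv∉ → edges⊄E (edges⊆ , _ , uv∈E , uv∉)))

  restrict~⁺ : ∀ {u v} → u S.~ v → Graph._~_ (restrict G edges) u v
  restrict~⁺ u~v = proj₁ (S.~⇒~ᴳ u~v) , combine∈edges⁺ u~v , combine∈edges⁺ (S.~-sym u~v)

  restrict-embeds : (∀ v → v ∈ S.vertices) → InducedEmbedding (restrict G edges) S.graph
  restrict-embeds spanning = record
    { injection = mk↣ {to = λ v → v , spanning v} (cong proj₁)
    ; ~-iff     = λ u v → mk⇔ (λ (_ , uv∈ , _) → combine∈edges⁻ uv∈) restrict~⁺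
    }

restrict-⊤-embeds : ∀ {n} (G : Graph (Fin n)) → InducedEmbedding (restrict G ⊤) G
restrict-⊤-embeds G = record
  { injection = mk↣ {to = λ v → v} (λ eq → eq)
  ; ~-iff     = λ u v → mk⇔ proj₁ (λ u~v → u~v , ∈⊤ , ∈⊤)
  }

-- Being H-free is not monotone under edge deletion, so edges cannot be removed
-- greedily: one takes a minimal edge set among the H-free non-colorable ones.
critical-spanning-subgraph : ∀ {n t k} (H : Graph (Fin t)) (G : Graph (Fin (suc n))) →
  H -Free G → ¬ Colorable k G → (∀ x → ColorableWithout k G x) →
  Σ (Graph (Fin (suc n))) (CriticalFree (suc k) H)
critical-spanning-subgraph {n} {t} {k} H G free ¬colorable without
  with ⊂-minimal Obstruction? {⊤} ⊤-obstruction
  where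
  Obstruction : Subset (suc n * suc n) → Set
  Obstruction E = H -Free restrict G E × ¬ Colorable k (restrict G E)

  Obstruction? : Decidable Obstruction
  Obstruction? E = ¬? (embedding? H (restrict G E)) ×-dec ¬? (colorable? k (restrict G E))

  ⊤-obstruction : Obstruction ⊤
  ⊤-obstruction =
    (λ e → free (embedding-trans e (restrict-⊤-embeds G))) ,
    (λ (c , proper) → ¬colorable (c , λ u~v → proper (u~v , ∈⊤ , ∈⊤)))
... | E , (freeᴱ , ¬colorableᴱ) , minimal = restrict G E , record
  { free      = freeᴱ
  ; chromatic = colorable-suc {G = restrict G E} (withoutᴱ zero) , ¬colorableᴱ
  ; critical  = critical
  }
  where
  withoutᴱ : ∀ x → ColorableWithout k (restrict G E) x
  withoutᴱ x = let c , proper = without x in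
    c , λ u≢x v≢x (u~v , _) → proper u≢x v≢x u~v

  critical : (S : Subgraph (restrict G E)) → Subgraph.Proper S →
             H -Free Subgraph.graph S → Colorable k (Subgraph.graph S)
  critical S proper freeˢ with all? (_∈? Subgraph.vertices S)
  -- `S` misses some vertex `x`, so a colouring that is proper away from `x` restricts to `S`.
  ... | no ¬spanning =
    let x , x∉ = ¬∀⟶∃¬ _ _ (_∈? vertices) ¬spanning
        c , proper = withoutᴱ x
    in c ∘ proj₁ , λ {u} {v} u~v → proper
         (λ u≡x → x∉ (subst (_∈ vertices) u≡x (proj₂ u)))
         (λ v≡x → x∉ (subst (_∈ vertices) v≡x (proj₂ v)))
         (~⇒~ᴳ u~v)
    where open Subgraph S
  ... | yes spanning with colorable? k (restrict G (edges G E S))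
  ...   | yes (c , properᶜ) = c ∘ proj₁ , λ u~v → properᶜ (restrict~⁺ G E S u~v)
  -- Here the edge set of the spanning `S` would be an obstruction strictly inside the minimal `E`.
  ...   | no ¬colorableˢ    = contradiction
    ((λ e → freeˢ (embedding-trans e (restrict-embeds G E S spanning))) , ¬colorableˢ)
    (minimal (edges⊂ G E S spanning proper))

-- Residues modulo 3

rot : Fin 3 → Fin 3
rot 0F = 1F
rot 1F = 2F
rot 2F = 0F

rot³ : ∀ a → rot (rot (rot a)) ≡ a
rot³ 0F = refl
rot³ 1F = refl
rot³ 2F = refl

rot≢ : ∀ a → rot a ≢ a
rot≢ 0F ()
rot≢ 1F ()
rot≢ 2F ()

rot²≢ : ∀ a → rot (rot a) ≢ a
rot²≢ 0F ()
rot²≢ 1F ()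
rot²≢ 2F ()

rot-flip : ∀ {a b} → rot a ≡ b → rot (rot b) ≡ a
rot-flip refl = rot³ _

rot-flip² : ∀ {a b} → rot (rot a) ≡ b → rot b ≡ a
rot-flip² refl = rot³ _

rot-injective : ∀ {a b} → rot a ≡ rot b → a ≡ b
rot-injective {a} {b} eq = trans (sym (rot³ a)) (trans (cong (rot ∘ rot) eq) (rot³ b))

rot-cases : ∀ {a b} → rot a ≢ b → a ≡ b ⊎ a ≡ rot b
rot-cases {0F} {0F} _ = inj₁ refl
rot-cases {0F} {1F} n = contradiction refl n
rot-cases {0F} {2F} _ = inj₂ refl
rot-cases {1F} {0F} _ = inj₂ refl
rot-cases {1F} {1F} _ = inj₁ refl
rot-cases {1F} {2F} n = contradiction refl n
rot-cases {2F} {0F} n = contradiction refl n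
rot-cases {2F} {1F} _ = inj₂ refl
rot-cases {2F} {2F} _ = inj₁ refl

-- Only one of three colours differs from both `b` and `c`; checked by evaluating all 81 cases.
third-color : (a b c d : Fin 3) → b ≢ c → a ≢ b → a ≢ c → d ≢ b → d ≢ c → a ≡ d
third-color = toWitness {a? = all? λ a → all? λ b → all? λ c → all? λ d →
  ¬? (b ≟ c) →-dec ¬? (a ≟ b) →-dec ¬? (a ≟ c) →-dec ¬? (d ≟ b) →-dec ¬? (d ≟ c) →-dec (a ≟ d)} _

residue : ℕ → Fin 3
residue zero    = 0F
residue (suc a) = rot (residue a)

residue-*3+ : ∀ r a → residue (r * 3 + a) ≡ residue a
residue-*3+ zero    a = refl
residue-*3+ (suc r) a = trans (rot³ _) (residue-*3+ r a)

-- The circulant graphs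

module Circulant (i : ℕ) where

  N : ℕ
  N = suc i * 3

  -- `jump` encodes `b` - `a` ≡ 2 (mod 3). Since N + 1 ≡ 1 (mod 3), going round the cycle the other
  -- way gives the same condition.
  data Link (a b : ℕ) : Set where
    step : suc a ≡ b → Link a b
    jump : a < b → rot (residue b) ≡ residue a → Link a b

  -- The closing edge `wrap` is kept apart from `Link` because it alone joins vertices of equal
  -- residue.
  data Arc (a b : ℕ) : Set where
    link : Link a b → Arc a b
    wrap : a ≡ 0 → b ≡ N → Arc a b

  Linked Adjacent : ℕ → ℕ → Set
  Linked   a b = Link a b ⊎ Link b a
  Adjacent a b = Arc a b ⊎ Arc b a

  link? : B.Decidable Link
  link? a b = map′ [ step , uncurry jump ]′
    (λ { (step eq) → inj₁ eq ; (jump a<b eq) → inj₂ (a<b , eq) })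
    ((suc a ℕ.≟ b) ⊎-dec ((a ℕ.<? b) ×-dec (rot (residue b) ≟ residue a)))

  arc? : B.Decidable Arc
  arc? a b = map′ [ link , uncurry wrap ]′
    (λ { (link l) → inj₁ l ; (wrap a≡0 b≡N) → inj₂ (a≡0 , b≡N) })
    (link? a b ⊎-dec ((a ℕ.≟ 0) ×-dec (b ℕ.≟ N)))

  link⇒< : ∀ {a b} → Link a b → a < b
  link⇒< (step refl)  = ℕ.n<1+n _
  link⇒< (jump a<b _) = a<b

  arc⇒< : ∀ {a b} → Arc a b → a < b
  arc⇒< (link l)        = link⇒< l
  arc⇒< (wrap refl refl) = s≤s z≤n

  link⇒residue≢ : ∀ {a b} → Link a b → residue a ≢ residue b
  link⇒residue≢ (step refl)  eq = rot≢ _ (sym eq)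
  link⇒residue≢ (jump _ r≡) eq = rot≢ _ (trans r≡ eq)

  linked⇒residue≢ : ∀ {a b} → Linked a b → residue a ≢ residue b
  linked⇒residue≢ = [ link⇒residue≢ , (λ l → ≢-sym (link⇒residue≢ l)) ]′

  residue-suc-N+ : ∀ a → residue (suc N + a) ≡ rot (residue a)
  residue-suc-N+ a = cong rot (residue-*3+ (suc i) a)

  graph : Graph (Fin (suc N))
  graph = record
    { _~_      = λ u v → Adjacent (toℕ u) (toℕ v)
    ; _~?_     = λ u v → arc? (toℕ u) (toℕ v) ⊎-dec arc? (toℕ v) (toℕ u)
    ; ~-sym    = swap
    ; ~-irrefl = λ { refl → [ ℕ.<-irrefl refl ∘ arc⇒< , ℕ.<-irrefl refl ∘ arc⇒< ]′ }
    }

  -- Cutting the cycle open at w: p is the representative of x modulo N + 1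
  -- with w < p ≤ w + N.  Up to this relabelling every w plays the role of 0.
  data Unrolled (w x : ℕ) : ℕ → Set where
    above : w < x → Unrolled w x x
    below : x < w → Unrolled w x (suc N + x)

  unroll : ∀ {w x} → x ≢ w → ∃ (Unrolled w x)
  unroll {w} {x} x≢w with ℕ.<-cmp w x
  ... | tri< w<x _ _ = _ , above w<x
  ... | tri≈ _ w≡x _ = contradiction (sym w≡x) x≢w
  ... | tri> _ _ x<w = _ , below x<w

  -- Invariance of adjacency under rotation.

  module _ {w : ℕ} (w≤N : w ≤ N) where

    -- The shift is by N + 1 ≡ 1 (mod 3). If `x` alone is shifted, `y` - `x` ≡ 2 turns into (N + 1 +
    -- `x`) - `y` ≡ 1 - 2 ≡ 2, a jump in reverse, while the pair 0, N becomes the consecutive pair N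
    -- + 1, N.
    arc⇒linked : ∀ {x y p q} → y ≤ N → Unrolled w x p → Unrolled w y q → Arc x y → Linked p q
    arc⇒linked _   (above w<x) (above _)   (link l)         = inj₁ l
    arc⇒linked _   (above w<0) (above _)   (wrap refl _)    = contradiction w<0 ℕ.n≮0
    arc⇒linked _   (above w<x) (below y<w) l                =
      contradiction (arc⇒< l) (ℕ.<-asym (ℕ.<-trans y<w w<x))
    arc⇒linked _   (below x<w) (above w<y) (link (step eq)) =
      contradiction (subst (_ <_) (sym eq) w<y) (ℕ.≤⇒≯ (x<w))
    arc⇒linked {x} {y} y≤N (below x<w) (above w<y) (link (jump _ r≡)) =
      inj₂ (jump (s≤s (ℕ.≤-trans y≤N (ℕ.m≤m+n N x)))
        (trans (cong rot (residue-suc-N+ x)) (rot-flip r≡)))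
    arc⇒linked _   (below _)   (above _)   (wrap refl refl) =
      inj₂ (step (cong suc (sym (ℕ.+-identityʳ N))))
    arc⇒linked {x} _ (below _) (below _)   (link (step refl)) =
      inj₁ (step (cong suc (sym (ℕ.+-suc N x))))
    arc⇒linked {x} {y} _ (below _) (below _) (link (jump x<y r≡)) =
      inj₁ (jump (ℕ.+-monoʳ-< (suc N) x<y)
        (trans (cong rot (residue-suc-N+ y)) (trans (cong rot r≡) (sym (residue-suc-N+ x)))))
    arc⇒linked _   (below _)   (below N<w) (wrap _ refl)    =
      contradiction w≤N (ℕ.<⇒≱ N<w)

    link⇒adjacent : ∀ {x y p q} → x ≤ N → y ≤ N → Unrolled w x p → Unrolled w y q → Link p q → Adjacent x y
    link⇒adjacent _ _ (above _) (above _) l = inj₁ (link l)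
    -- Consecutive representatives on either side of the shift force `x` = N and `y` = 0, the
    -- closing edge.
    link⇒adjacent {x} {y} x≤N _ (above w<x) (below y<w) (step eq) = inj₂ (wrap y≡0 x≡N)
      where
      x≡N+y : x ≡ N + y
      x≡N+y = ℕ.suc-injective eq
      y≡0 : y ≡ 0
      y≡0 = ℕ.n≤0⇒n≡0 (ℕ.+-cancelˡ-≤ N _ _
        (subst₂ _≤_ x≡N+y (sym (ℕ.+-identityʳ N)) x≤N))
      x≡N : x ≡ N
      x≡N = trans x≡N+y (trans (cong (N +_) y≡0) (ℕ.+-identityʳ N))
    link⇒adjacent {x} {y} _ _ (above w<x) (below y<w) (jump _ r≡) =
      inj₂ (link (jump (ℕ.<-trans y<w w<x)
        (rot-flip² (trans (sym (cong rot (residue-suc-N+ y))) r≡))))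
    link⇒adjacent {x} _ y≤N (below _) (above _) l =
      contradiction (ℕ.≤-trans (link⇒< l) y≤N) (ℕ.<⇒≱ (s≤s (ℕ.m≤n⇒m≤1+n (ℕ.m≤m+n N x))))
    link⇒adjacent {x} {y} _ _ (below _) (below _) (step eq) =
      inj₁ (link (step (ℕ.+-cancelˡ-≡ (suc N) _ _ (trans (ℕ.+-suc (suc N) x) eq))))
    link⇒adjacent {x} {y} _ _ (below _) (below _) (jump p<q r≡) =
      inj₁ (link (jump (ℕ.+-cancelˡ-< (suc N) _ _ p<q)
        (rot-injective (trans (sym (cong rot (residue-suc-N+ y))) (trans r≡ (residue-suc-N+ x))))))

    adjacent⇒linked : ∀ {x y p q} → x ≤ N → y ≤ N → Unrolled w x p → Unrolled w y q →
                      Adjacent x y → Linked p q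
    adjacent⇒linked x≤N y≤N ux uy =
      [ arc⇒linked y≤N ux uy , (λ l → swap (arc⇒linked x≤N uy ux l)) ]′

    linked⇒adjacent : ∀ {x y p q} → x ≤ N → y ≤ N → Unrolled w x p → Unrolled w y q →
                      Linked p q → Adjacent x y
    linked⇒adjacent x≤N y≤N ux uy =
      [ link⇒adjacent x≤N y≤N ux uy , (λ l → swap (link⇒adjacent y≤N x≤N uy ux l)) ]′

    -- If the residue of `p` were two past that of `w`, a jump would join `x` to `w`; two classes
    -- remain.
    nonadjacent-residue : ∀ {x p} → Unrolled w x p → ¬ Adjacent w x →
                          residue p ≡ residue w ⊎ residue p ≡ rot (residue w)
    nonadjacent-residue (above w<x) w≁x = rot-cases λ r≡ → w≁x (inj₁ (link (jump w<x r≡)))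
    nonadjacent-residue {x} (below x<w) w≁x = rot-cases λ r≡ →
      w≁x (inj₂ (link (jump x<w (rot-flip² (trans (sym (cong rot (residue-suc-N+ x))) r≡)))))

  -- Two adjacent residue classes induce a half graph.
  module _ {p q : ℕ} (q≡rot-p : residue q ≡ rot (residue p)) where

    linked⇒≤ : Linked p q → q ≤ suc p
    linked⇒≤ (inj₁ (step refl)) = ℕ.≤-refl
    linked⇒≤ (inj₁ (jump _ r≡)) = contradiction (trans (sym (cong rot q≡rot-p)) r≡) (rot²≢ _)
    linked⇒≤ (inj₂ l)           = ℕ.≤-trans (ℕ.<⇒≤ (link⇒< l)) (ℕ.n≤1+n p)

    ≤⇒linked : q ≤ suc p → Linked p q
    ≤⇒linked q≤1+p with ℕ.m≤n⇒m<n∨m≡n q≤1+p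
    ... | inj₂ q≡1+p = inj₁ (step (sym q≡1+p))
    ... | inj₁ q<1+p with ℕ.m≤n⇒m<n∨m≡n (s≤s⁻¹ q<1+p)
    ...   | inj₁ q<p  = inj₂ (jump q<p (sym q≡rot-p))
    ...   | inj₂ refl = contradiction (sym q≡rot-p) (rot≢ _)

  -- Neighbourhoods in a half graph are nested: the smaller of `q` and `q′` is joined to both `p`
  -- and `p′`.
  crossing : ∀ {c p q p′ q′} → residue p ≡ c → residue q ≡ rot c → residue p′ ≡ c → residue q′ ≡ rot c →
             Linked p q → Linked p′ q′ → Linked p q′ ⊎ Linked p′ q
  crossing {q = q} {q′ = q′} refl qr p′r q′r p~q p′~q′ with ℕ.≤-total q q′
  ... | inj₁ q≤q′ = inj₂ (≤⇒linked (trans qr (cong rot (sym p′r)))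
    (ℕ.≤-trans q≤q′ (linked⇒≤ (trans q′r (cong rot (sym p′r))) p′~q′)))
  ... | inj₂ q′≤q = inj₁ (≤⇒linked q′r (ℕ.≤-trans q′≤q (linked⇒≤ qr p~q)))

  orient : ∀ {c p q} → residue p ≡ c ⊎ residue p ≡ rot c → residue q ≡ c ⊎ residue q ≡ rot c →
           Linked p q → (residue p ≡ c × residue q ≡ rot c) ⊎ (residue q ≡ c × residue p ≡ rot c)
  orient (inj₁ pr) (inj₂ qr) _   = inj₁ (pr , qr)
  orient (inj₂ pr) (inj₁ qr) _   = inj₂ (qr , pr)
  orient (inj₁ pr) (inj₁ qr) p~q = contradiction (trans pr (sym qr)) (linked⇒residue≢ p~q)
  orient (inj₂ pr) (inj₂ qr) p~q = contradiction (trans pr (sym qr)) (linked⇒residue≢ p~q)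

  -- Once each edge is oriented from class `c` to class `rot c`, `crossing` applies; the four cases
  -- record which cross pair it yields.
  crossed : ∀ {c p q p′ q′} →
    residue p  ≡ c ⊎ residue p  ≡ rot c → residue q  ≡ c ⊎ residue q  ≡ rot c →
    residue p′ ≡ c ⊎ residue p′ ≡ rot c → residue q′ ≡ c ⊎ residue q′ ≡ rot c →
    Linked p q → Linked p′ q′ →
    (Linked p p′ ⊎ Linked p q′) ⊎ (Linked q p′ ⊎ Linked q q′)
  crossed pr qr p′r q′r p~q p′~q′ with orient pr qr p~q | orient p′r q′r p′~q′
  ... | inj₁ (a , b) | inj₁ (a′ , b′) =
    [ inj₁ ∘ inj₂ , inj₂ ∘ inj₁ ∘ swap ]′ (crossing a b a′ b′ p~q p′~q′)
  ... | inj₁ (a , b) | inj₂ (a′ , b′) =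
    [ inj₁ ∘ inj₁ , inj₂ ∘ inj₂ ∘ swap ]′ (crossing a b a′ b′ p~q (swap p′~q′))
  ... | inj₂ (a , b) | inj₁ (a′ , b′) =
    [ inj₂ ∘ inj₂ , inj₁ ∘ inj₁ ∘ swap ]′ (crossing a b a′ b′ (swap p~q) p′~q′)
  ... | inj₂ (a , b) | inj₂ (a′ , b′) =
    [ inj₂ ∘ inj₁ , inj₁ ∘ inj₂ ∘ swap ]′ (crossing a b a′ b′ (swap p~q) (swap p′~q′))

  -- The first, second, fourth, fifth and seventh vertex of a P₇ induce 2K₂ + K₁.
  path-free : Path 7 -Free graph
  path-free e = [ [ absent 0F 3F (λ { (inj₁ ()) ; (inj₂ ()) })
                  , absent 0F 4F (λ { (inj₁ ()) ; (inj₂ ()) }) ]′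
                , [ absent 1F 3F (λ { (inj₁ ()) ; (inj₂ ()) })
                  , absent 1F 4F (λ { (inj₁ ()) ; (inj₂ ()) }) ]′ ]′
    (crossed (far 0F λ { (inj₁ ()) ; (inj₂ ()) }) (far 1F λ { (inj₁ ()) ; (inj₂ ()) })
             (far 3F λ { (inj₁ ()) ; (inj₂ ()) }) (far 4F λ { (inj₁ ()) ; (inj₂ ()) })
             (present 0F 1F (inj₁ refl)) (present 3F 4F (inj₁ refl)))
    where
    open InducedEmbedding e
    open Graph (Path 7) using (_~_)
    f : Fin 7 → ℕ
    f = toℕ ∘ Injection.to injection
    f≤N : ∀ x → f x ≤ N
    f≤N x = toℕ≤pred[n] (Injection.to injection x)
    -- The cut is made at the seventh path vertex, so that its non-neighbours fall into the two
    -- classes required by `crossed`.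
    unrolled : ∀ x → {x≢6 : False (x ≟ 6F)} → ∃ (Unrolled (f 6F) (f x))
    unrolled x {x≢6} = unroll (toWitnessFalse x≢6 ∘ Injection.injective injection ∘ toℕ-injective)
    far : ∀ x {x≢6 : False (x ≟ 6F)} → ¬ 6F ~ x →
          let p = proj₁ (unrolled x {x≢6}) in
          residue p ≡ residue (f 6F) ⊎ residue p ≡ rot (residue (f 6F))
    far x {x≢6} 6≁x = nonadjacent-residue (f≤N 6F) (proj₂ (unrolled x {x≢6}))
      (6≁x ∘ Equivalence.from (~-iff 6F x))
    present : ∀ x y {x≢6 : False (x ≟ 6F)} {y≢6 : False (y ≟ 6F)} → x ~ y →
              Linked (proj₁ (unrolled x {x≢6})) (proj₁ (unrolled y {y≢6}))
    present x y {x≢6} {y≢6} x~y = adjacent⇒linked (f≤N 6F) (f≤N x) (f≤N y)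
      (proj₂ (unrolled x {x≢6})) (proj₂ (unrolled y {y≢6})) (Equivalence.to (~-iff x y) x~y)
    absent : ∀ x y {x≢6 : False (x ≟ 6F)} {y≢6 : False (y ≟ 6F)} → ¬ x ~ y →
             ¬ Linked (proj₁ (unrolled x {x≢6})) (proj₁ (unrolled y {y≢6}))
    absent x y {x≢6} {y≢6} x≁y l = x≁y (Equivalence.from (~-iff x y)
      (linked⇒adjacent (f≤N 6F) (f≤N x) (f≤N y) (proj₂ (unrolled x {x≢6})) (proj₂ (unrolled y {y≢6})) l))

  -- After cutting at `x`, every edge avoiding `x` becomes a link, and links join distinct residues.
  colorable-without : ∀ x → ColorableWithout 3 graph x
  colorable-without x = color , proper
    where
    color : Fin (suc N) → Fin 3
    color u with u ≟ x
    -- An arbitrary value, as nothing is demanded at `x`.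
    ... | yes _  = 0F
    ... | no u≢x = residue (proj₁ (unroll (u≢x ∘ toℕ-injective)))
    proper : ∀ {u v} → u ≢ x → v ≢ x → Graph._~_ graph u v → color u ≢ color v
    proper {u} {v} u≢x v≢x u~v with u ≟ x | v ≟ x
    ... | yes u≡x | _       = contradiction u≡x u≢x
    ... | no _    | yes v≡x = contradiction v≡x v≢x
    ... | no u≢   | no v≢   = linked⇒residue≢ (adjacent⇒linked (toℕ≤pred[n] x)
      (toℕ≤pred[n] u) (toℕ≤pred[n] v) (proj₂ (unroll (u≢ ∘ toℕ-injective)))
      (proj₂ (unroll (v≢ ∘ toℕ-injective))) u~v)

  -- Any three consecutive vertices form a triangle, so a 3-coloring of
  -- 0, 1, …, N has period 3; but 0 and N = 3 (i + 1) are adjacent.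
  ¬colorable : ¬ Colorable 3 graph
  ¬colorable (c , proper) =
    properℕ z≤n ℕ.≤-refl (wrap refl refl) (sym (periodic (suc i) ℕ.≤-refl))
    where
    -- The bound is irrelevant, so different proofs of it give definitionally equal colours.
    d : ∀ a → .(a ≤ N) → Fin 3
    d a a≤N = c (fromℕ< (s≤s a≤N))

    properℕ : ∀ {a b} .(a≤N : a ≤ N) .(b≤N : b ≤ N) → Arc a b → d a a≤N ≢ d b b≤N
    properℕ a≤N b≤N l = proper (inj₁ (subst₂ Arc
      (sym (toℕ-fromℕ< (s≤s a≤N))) (sym (toℕ-fromℕ< (s≤s b≤N))) l))

    skip : ∀ a → Arc a (2 + a)
    skip a = link (jump (s≤s (ℕ.n≤1+n a)) (rot³ _))

    period : ∀ a (le : 3 + a ≤ N) → d a (ℕ.m+n≤o⇒n≤o 3 le) ≡ d (3 + a) le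
    period a le = third-color _ (d (1 + a) le₁) (d (2 + a) le₂) _
      (properℕ le₁ le₂ (link (step refl)))
      (properℕ le₀ le₁ (link (step refl)))
      (properℕ le₀ le₂ (skip a))
      (≢-sym (properℕ le₁ le (skip (1 + a))))
      (≢-sym (properℕ le₂ le (link (step refl))))
      where
      le₀ = ℕ.m+n≤o⇒n≤o 3 le
      le₁ = ℕ.m+n≤o⇒n≤o 2 le
      le₂ = ℕ.m+n≤o⇒n≤o 1 le

    periodic : ∀ r (le : r * 3 ≤ N) → d (r * 3) le ≡ d 0 z≤n
    periodic zero    le = refl
    periodic (suc r) le = trans (sym (period (r * 3) le)) (periodic r (ℕ.m+n≤o⇒n≤o 3 le))

  criticalSubgraph : Σ (Graph (Fin (suc N))) (CriticalFree 4 (Path 7))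
  criticalSubgraph = critical-spanning-subgraph (Path 7) graph path-free ¬colorable colorable-without

lemma13 : Σ (ℕ → FiniteGraph) λ G →
    (∀ i → CriticalFree 4 (Path 7) (proj₂ (G i))) ×
    (∀ i j → i ≢ j → ¬ (proj₂ (G i) ≅ proj₂ (G j)))
lemma13 =
  (λ i → _ , proj₁ (Circulant.criticalSubgraph i)) ,
  (λ i → proj₂ (Circulant.criticalSubgraph i)) ,
  -- A bijection of the vertex sets equates 3 (`i` + 1) + 1 with 3 (`j` + 1) + 1.
  λ i j i≢j iso → i≢j (ℕ.suc-injective (ℕ.*-cancelʳ-≡ (suc i) (suc j) 3
    (ℕ.suc-injective (↔⇒≡ (_≅_.bijection iso)))))
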